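{- For $1\le i\le n$ let $H_i\colon\mathsf{Set}\to\mathsf{Set}$ be a functor with encoding (labels $A_i$, maps $\flat_i$) and refinement interface with weights $W_i$, functions $\mathsf{init}_i$, $\mathsf{update}_i$ and weight maps $w_i$. Let $H=\coprod_iH_i$, $A=\coprod_iA_i$, $W=\coprod_iW_i$, let $\mathrm{in}_i$ denote coproduct injections, and put $\mathsf{filter}_i\colon\mathcal{B}_{\mathrm f}(\coprod_jA_j)\to\mathcal{B}_{\mathrm f}(A_i)$, $\mathsf{filter}_i(g)(a)=g(\mathrm{in}_i(a))$. Define - $\flat\colon\coprod_iH_iY\to\mathcal{B}_{\mathrm f}(\coprod_iA_i\times Y)$ by $\flat(\mathrm{in}_i(t))=\mathcal{B}_{\mathrm f}(\mathrm{in}_i\times Y)(\flat_i(t))$; - $w(S)=\coprod_iw_i(S)\colon\coprod_iH_iY\to\coprod_iW_i$ for $S\subseteq Y$; - $\mathsf{init}\colon\coprod_iH_i1\times\mathcal{B}_{\mathrm f}A\to W$ by $\mathsf{init}(\mathrm{in}_i(t),a)=\mathrm{in}_i(\mathsf{init}_i(t,\mathsf{filter}_i(a)))$; - $\mathsf{update}\colon\mathcal{B}_{\mathrm f}A\times W\to W\times\coprod_iH_i3\times W$ by $\mathsf{update}(a,\mathrm{in}_i(t))=(\mathrm{in}_i\times\mathrm{in}_i\times\mathrm{in}_i)(\mathsf{update}_i(\mathsf{filter}_i(a),t))$. Then $W$, $A$, $\flat$, $\mathsf{init}$, $w$, $\mathsf{update}$ form a refinement interface for $H=\coprod_iH_i$.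 Moreover, if for every $i$ the functor $H_i$ is zippable, $\mathsf{init}_i$ and $\mathsf{update}_i$ run in linear time, $H_i3$ is linearly ordered and its elements can be compared in constant time, then the same holds for $H$ with $\mathsf{init}$ and $\mathsf{update}$.
   Context: Sets: $1=\{0\}$, $3=\{0,1,2\}$; $!\colon X\to 1$ is the unique map. $\mathcal{B}_{\mathrm f}Z$ is the set of finite multisets (bags) on $Z$, i.e. finitely supported maps $Z\to\mathbb{N}$, with functor action $\mathcal{B}_{\mathrm f}h(g)(z')=\sum_{h(z)=z'}g(z)$. Coproducts of functors are formed pointwise. Bags are represented as lists in computations; linear time refers to the size of the input. A functor $H\colon\mathsf{Set}\to\mathsf{Set}$ is zippable if for all sets $A,B$ the map $\langle H(A+!),H(!+B)\rangle\colon H(A+B)\to H(A+1)\times H(1+B)$ is injective. An encoding of a functor $H$ consists of a set $A$ of labels and a family of maps $\flat\colon HX\to\mathcal{B}_{\mathrm f}(A\times X)$, one for every set $X$ (not necessarily natural in $X$). For $S\subseteq C\subseteq X$, $\chi_S^C\colon X\to 3$ maps $x$ to $2$ if $x\in S$, to $1$ if $x\in C\setminus S$, and to $0$ if $x\in X\setminus C$. For $S\subseteq X$, $\mathsf{fil}_S\colon\mathcal{B}_{\mathrm f}(A\times X)\to\mathcal{B}_{\mathrm f}A$ is $\mathsf{fil}_S(g)(a)=\sum_{y\in S}g(a,y)$. A refinement interface for $H$ (with encoding) consists of a set $W$ of weights and functions $\mathsf{init}\colon H1\times\mathcal{B}_{\mathrm f}A\to W$ and $\mathsf{update}\colon\mathcal{B}_{\mathrm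 f}A\times W\to W\times H3\times W$ such that there exists a family of weight maps $w\colon\mathcal{P}_{\mathrm f}X\to(HX\to W)$ (for finite sets $X$) satisfying, for all $S\subseteq C\subseteq X$: $\mathsf{init}\cdot\langle H!,\mathsf{fil}_X\cdot\flat\rangle=w(X)$ and $\mathsf{update}\cdot\langle\mathsf{fil}_S\cdot\flat,\,w(C)\rangle=\langle w(S),\,H\chi_S^C,\,w(C\setminus S)\rangle$ as maps on $HX$. "Form a refinement interface" means that these two equations hold for the given data. -}

module Defs where

open import Axiom.ExcludedMiddle using (ExcludedMiddle)
open import Axiom.UniquenessOfIdentityProofs using (module Decidable⇒UIP)
open import Data.Bool.Base using (Bool; true; false; if_then_else_)
open import Data.Fin.Base using (Fin; zero; suc)
open import Data.Fin.Properties using (_≟_)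
open import Data.List.Base as List using (List; []; _∷_; foldr; filter; length; deduplicate)
open import Data.List.Membership.Propositional using (_∈_)
open import Data.List.Membership.Propositional.Properties using (∈-map⁺)
open import Data.List.Relation.Unary.Any using (here; there)
open import Data.Nat.Base using (ℕ; zero; suc; _+_; _*_; _≤_)
open import Data.Nat.ListAction using (sum)
open import Data.Product.Base using (Σ; ∃; _×_; _,_; proj₁; proj₂; map₁)
open import Data.Product.Properties using (,-injectiveˡ; ,-injectiveʳ-UIP)
open import Data.Sum.Base as Sum using (_⊎_)
open import Data.Unit.Base using (⊤; tt)
open import Function.Base using (_∘_; id)
open import Function.Bundles using (_↔_; _⇔_)
open import Function.Definitions using (Injective)
open import Level using (0ℓ)
open import Relation.Binary.Core using (Rel)
open import Relation.Binary.Definitions using (DecidableEquality)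
open import Relation.Binary.PropositionalEquality using (_≡_; _≢_; refl; sym; trans; cong; _≗_)
open import Relation.Binary.Structures using (IsTotalOrder)
open import Relation.Nullary using (yes; no; does; contradiction)
open import Relation.Unary using (Pred; U; _⊆_; _∖_; _≐_)

------------------------------------------------------------------------
-- Functors Set → Set

-- Functions are compared pointwise; fmap-cong replaces function
-- extensionality.

record Functor : Set₁ where
  field
    F₀        : Set → Set
    fmap      : {X Y : Set} → (X → Y) → F₀ X → F₀ Y
    fmap-id   : {X : Set} → fmap {X} id ≗ id
    fmap-∘    : {X Y Z : Set} (g : Y → Z) (f : X → Y) → fmap (g ∘ f) ≗ fmap g ∘ fmap f
    fmap-cong : {X Y : Set} {f g : X → Y} → f ≗ g → fmap f ≗ fmap g

open Functor public

∐ : {n : ℕ} → (Fin n → Functor) → Functor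
∐ H .F₀ X                  = Σ _ λ i → F₀ (H i) X
∐ H .fmap f (i , t)        = i , fmap (H i) f t
∐ H .fmap-id (i , t)       = cong (i ,_) (fmap-id (H i) t)
∐ H .fmap-∘ g f (i , t)    = cong (i ,_) (fmap-∘ (H i) g f t)
∐ H .fmap-cong f≗g (i , t) = cong (i ,_) (fmap-cong (H i) f≗g t)

𝟏 𝟑 : Set
𝟏 = Fin 1
𝟑 = Fin 3

! : {X : Set} → X → 𝟏
! _ = zero

Zippable : Functor → Set₁
Zippable H = (A B : Set) → Injective _≡_ _≡_ (unzip A B)
  where
  unzip : (A B : Set) → F₀ H (A ⊎ B) → F₀ H (A ⊎ 𝟏) × F₀ H (𝟏 ⊎ B)
  unzip A B t = fmap H (Sum.map id !) t , fmap H (Sum.map ! id) t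

Finite : Set → Set
Finite X = ∃ λ n → X ↔ Fin n

------------------------------------------------------------------------
-- Bags: finitely supported maps to ℕ

-- The list `support` need only contain every z with mult z ≢ 0; it may
-- have repetitions and further elements.  Equality of bags is therefore
-- _≈_, which ignores it.

record Bag (Z : Set) : Set where
  field
    mult      : Z → ℕ
    support   : List Z
    supported : ∀ z → mult z ≢ 0 → z ∈ support

open Bag public

infix 4 _≈_

_≈_ : {Z : Set} → Bag Z → Bag Z → Set
g ≈ g′ = mult g ≗ mult g′

sumOf : {Z : Set} → List Z → (Z → ℕ) → ℕ
sumOf zs f = sum (List.map f zs)

sumOf-≢0 : {Z : Set} (zs : List Z) (f : Z → ℕ) → sumOf zs f ≢ 0 → ∃ λ z → f z ≢ 0
sumOf-≢0 []       f s≢0 = contradiction refl s≢0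
sumOf-≢0 (z ∷ zs) f s≢0 with f z in eq
... | zero  = sumOf-≢0 zs f s≢0
... | suc _ = z , λ fz≡0 → contradiction (trans (sym eq) fz≡0) λ ()

if-≢0 : (b : Bool) {m : ℕ} → (if b then m else 0) ≢ 0 → b ≡ true × m ≢ 0
if-≢0 true  m≢0 = refl , m≢0
if-≢0 false 0≢0 = contradiction refl 0≢0

module _ {n : ℕ} {A : Fin n → Set} (i : Fin n) where

  -- Keeps the entries of the form (i , a).
  select : List (Σ (Fin n) A) → List (A i)
  select []             = []
  select ((j , a) ∷ zs) with j ≟ i
  ... | yes refl = a ∷ select zs
  ... | no _     = select zs

  select-∈ : ∀ {a} zs → (i , a) ∈ zs → a ∈ select zs
  select-∈ ((j , b) ∷ zs) p with j ≟ i
  select-∈ ((j , b) ∷ zs) (here refl) | yes refl = here refl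
  select-∈ ((j , b) ∷ zs) (there p)   | yes refl = there (select-∈ zs p)
  select-∈ ((j , b) ∷ zs) (here refl) | no j≢i   = contradiction refl j≢i
  select-∈ ((j , b) ∷ zs) (there p)   | no j≢i   = select-∈ zs p

  filterᵢ : Bag (Σ (Fin n) A) → Bag (A i)
  filterᵢ g .mult a        = mult g (i , a)
  filterᵢ g .support       = select (support g)
  filterᵢ g .supported a p = select-∈ (support g) (supported g (i , a) p)

module Classical (em : ExcludedMiddle 0ℓ) where

  ----------------------------------------------------------------------
  -- Operations on bags

  decEq : {Z : Set} → DecidableEquality Z
  decEq _ _ = em

  -- The sum of f z over all z in the set P; correct whenever f vanishes
  -- on the elements of P that do not occur in zs.
  ∑[_∈_]_ : {Z : Set} → List Z → Pred Z 0ℓ → (Z → ℕ) → ℕ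
  ∑[ zs ∈ P ] f = sumOf (deduplicate decEq zs) λ z → if does (em {P z}) then f z else 0

  ∑-≢0 : {Z : Set} (zs : List Z) (P : Pred Z 0ℓ) (f : Z → ℕ) →
         ∑[ zs ∈ P ] f ≢ 0 → ∃ λ z → P z × f z ≢ 0
  ∑-≢0 zs P f s≢0 with sumOf-≢0 (deduplicate decEq zs) _ s≢0
  ... | z , q with em {P z}
  ... | yes Pz = z , Pz , q
  ... | no _   = contradiction refl q

  mapᵇ : {Z Z′ : Set} → (Z → Z′) → Bag Z → Bag Z′
  mapᵇ h g .mult z′ = ∑[ support g ∈ (λ z → h z ≡ z′) ] mult g
  mapᵇ h g .support = List.map h (support g)
  mapᵇ h g .supported z′ p with ∑-≢0 (support g) _ (mult g) p
  ... | z , refl , q = ∈-map⁺ h (supported g z q)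

  fil : {A X : Set} → Pred X 0ℓ → Bag (A × X) → Bag A
  fil S g .mult a = ∑[ List.map proj₂ (support g) ∈ S ] λ y → mult g (a , y)
  fil S g .support = List.map proj₁ (support g)
  fil S g .supported a p with ∑-≢0 (List.map proj₂ (support g)) S (λ y → mult g (a , y)) p
  ... | y , _ , q = ∈-map⁺ proj₁ (supported g (a , y) q)

  occurrences : {Z : Set} → Z → List Z → ℕ
  occurrences z zs = length (filter (decEq z) zs)

  occurrences-∈ : {Z : Set} (z : Z) (zs : List Z) → occurrences z zs ≢ 0 → z ∈ zs
  occurrences-∈ z []       p = contradiction refl p
  occurrences-∈ z (y ∷ zs) p with decEq z y
  ... | yes z≡y = here z≡y
  ... | no _    = there (occurrences-∈ z zs p)

  ⌊_⌋ : {Z : Set} → List Z → Bag Z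
  ⌊ zs ⌋ .mult z        = occurrences z zs
  ⌊ zs ⌋ .support       = zs
  ⌊ zs ⌋ .supported z p = occurrences-∈ z zs p

  ----------------------------------------------------------------------
  -- Encodings and refinement interfaces

  χ : {X : Set} → Pred X 0ℓ → Pred X 0ℓ → X → 𝟑
  χ S C x = if does (em {S x}) then suc (suc zero)
            else if does (em {C x}) then suc zero
            else zero

  record Encoding (H : Functor) : Set₁ where
    field
      Label : Set
      ♭     : (X : Set) → F₀ H X → Bag (Label × X)

  open Encoding public

  record InterfaceData (H : Functor) (E : Encoding H) : Set₁ where
    field
      Weight : Set
      init   : F₀ H 𝟏 × Bag (Label E) → Weight
      update : Bag (Label E) × Weight → Weight × F₀ H 𝟑 × Weight
      -- The proof of finiteness is irrelevant, and the set of all subsets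
      -- of a finite X is 𝒫f X.
      weight : (X : Set) → .(Finite X) → Pred X 0ℓ → F₀ H X → Weight

  open InterfaceData public

  -- The fields *-cong say that init, update and weight are maps on bags
  -- and on subsets, which are considered up to _≈_ and _≐_.
  record IsRefinementInterface {H : Functor} (E : Encoding H) (D : InterfaceData H E) : Set₁ where
    field
      init-cong   : ∀ t {g g′} → g ≈ g′ → init D (t , g) ≡ init D (t , g′)
      update-cong : ∀ {g g′} v → g ≈ g′ → update D (g , v) ≡ update D (g′ , v)
      weight-cong : ∀ X .(fin : Finite X) {S S′ : Pred X 0ℓ} → S ≐ S′ →
                    weight D X fin S ≗ weight D X fin S′

      init-weight   : ∀ X .(fin : Finite X) (t : F₀ H X) →
                      init D (fmap H ! t , fil U (♭ E X t)) ≡ weight D X fin U t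
      update-weight : ∀ X .(fin : Finite X) (S C : Pred X 0ℓ) → S ⊆ C → (t : F₀ H X) →
                      update D (fil S (♭ E X t) , weight D X fin C t)
                      ≡ (weight D X fin S t , fmap H (χ S C) t , weight D X fin (C ∖ S) t)

  module _ {n : ℕ} {H : Fin n → Functor} where

    ∐ᴱ : (∀ i → Encoding (H i)) → Encoding (∐ H)
    ∐ᴱ E .Label       = Σ (Fin n) λ i → Label (E i)
    ∐ᴱ E .♭ X (i , t) = mapᵇ (map₁ (i ,_)) (♭ (E i) X t)

    ∐ᴰ : {E : ∀ i → Encoding (H i)} → (∀ i → InterfaceData (H i) (E i)) →
         InterfaceData (∐ H) (∐ᴱ E)
    ∐ᴰ D .Weight                 = Σ (Fin n) λ i → Weight (D i)
    ∐ᴰ D .init ((i , t) , a)     = i , init (D i) (t , filterᵢ i a)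
    ∐ᴰ D .update (a , (i , v))   =
      let v₁ , t , v₂ = update (D i) (filterᵢ i a , v) in (i , v₁) , (i , t) , (i , v₂)
    ∐ᴰ D .weight X fin S (i , t) = i , weight (D i) X fin S t

------------------------------------------------------------------------
-- A cost model

-- Programs over a first-order language with finite products, finite
-- tagged sums, lists and iteration over lists.  Everything else a
-- machine can do is an operation of the machine, with its own running
-- time; the base types come with their own notion of size.

infixr 7 _`×_

data Ty (Base : Set) : Set where
  base : Base → Ty Base
  `1   : Ty Base
  _`×_ : Ty Base → Ty Base → Ty Base
  `∐   : (n : ℕ) → (Fin n → Ty Base) → Ty Base
  list : Ty Base → Ty Base

module Values {Base : Set} (Carrier : Base → Set) where

  ⟦_⟧ : Ty Base → Set
  ⟦ base b ⟧ = Carrier b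
  ⟦ `1 ⟧     = ⊤
  ⟦ σ `× τ ⟧ = ⟦ σ ⟧ × ⟦ τ ⟧
  ⟦ `∐ n σ ⟧ = Σ (Fin n) λ i → ⟦ σ i ⟧
  ⟦ list σ ⟧ = List ⟦ σ ⟧

record Machine : Set₁ where
  field
    Base     : Set
    Carrier  : Base → Set
    baseSize : (b : Base) → Carrier b → ℕ

  open Values Carrier public

  field
    Op     : Ty Base → Ty Base → Set
    opEval : ∀ {σ τ} → Op σ τ → ⟦ σ ⟧ → ⟦ τ ⟧
    opCost : ∀ {σ τ} → Op σ τ → ⟦ σ ⟧ → ℕ

module Programs (M : Machine) where

  open Machine M public

  private variable
    ρ σ τ : Ty Base

  size : (σ : Ty Base) → ⟦ σ ⟧ → ℕ
  size (base b) x       = baseSize b x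
  size `1 _             = 1
  size (σ `× τ) (x , y) = size σ x + size τ y
  size (`∐ n σ) (i , x) = 1 + size (σ i) x
  size (list σ) xs      = 1 + sum (List.map (λ x → 1 + size σ x) xs)

  infixr 5 _⨾_

  data Prog : Ty Base → Ty Base → Set where
    op    : Op σ τ → Prog σ τ
    skip  : Prog σ σ
    _⨾_   : Prog ρ σ → Prog σ τ → Prog ρ τ
    unit  : Prog σ `1
    fork  : Prog ρ σ → Prog ρ τ → Prog ρ (σ `× τ)
    fst   : Prog (σ `× τ) σ
    snd   : Prog (σ `× τ) τ
    inj   : ∀ {n} {σ : Fin n → Ty Base} (i : Fin n) → Prog (σ i) (`∐ n σ)
    case  : ∀ {n} {σ : Fin n → Ty Base} → ((i : Fin n) → Prog (ρ `× σ i) τ) →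
            Prog (ρ `× `∐ n σ) τ
    nil   : Prog ρ (list σ)
    cons  : Prog (σ `× list σ) (list σ)
    fold  : Prog ρ τ → Prog (ρ `× σ `× τ) τ → Prog (ρ `× list σ) τ

  eval : Prog σ τ → ⟦ σ ⟧ → ⟦ τ ⟧
  eval (op o)     x             = opEval o x
  eval skip       x             = x
  eval (p ⨾ q)    x             = eval q (eval p x)
  eval unit       x             = tt
  eval (fork p q) x             = eval p x , eval q x
  eval fst        (x , y)       = x
  eval snd        (x , y)       = y
  eval (inj i)    x             = i , x
  eval (case p)   (x , i , y)   = eval (p i) (x , y)
  eval nil        x             = []
  eval cons       (x , xs)      = x ∷ xs
  eval (fold p q) (x , ys)      = foldr (λ y r → eval q (x , y , r)) (eval p x) ys

  cost : Prog σ τ → ⟦ σ ⟧ → ℕ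
  cost (op o)     x            = 1 + opCost o x
  cost (p ⨾ q)    x            = 1 + (cost p x + cost q (eval p x))
  cost (fork p q) x            = 1 + (cost p x + cost q x)
  cost (case p)   (x , i , y)  = 1 + cost (p i) (x , y)
  cost (fold p q) (x , [])     = 1 + cost p x
  cost (fold p q) (x , y ∷ ys) =
    1 + (cost q (x , y , eval (fold p q) (x , ys)) + cost (fold p q) (x , ys))
  cost _          _            = 1

  -- p maps the representation `inp x` of every x to the representation
  -- `out x` of the result, in time O(size of inp x).
  LinearTime : {I : Set} (σ τ : Ty Base) → (I → ⟦ σ ⟧) → (I → ⟦ τ ⟧) → Set
  LinearTime σ τ inp out =
    ∃ λ (p : Prog σ τ) →
      (∀ x → eval p (inp x) ≡ out x) ×
      ∃ λ c → ∀ x → cost p (inp x) ≤ c * (1 + size σ (inp x))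

  `Bool : Ty Base
  `Bool = `∐ 2 λ _ → `1

  `true : ⟦ `Bool ⟧
  `true = zero , tt

  record Representation (X : Set) : Set where
    field
      code      : Ty Base
      enc       : X → ⟦ code ⟧
      injective : Injective _≡_ _≡_ enc

  open Representation public

  ∐ᴿ : {n : ℕ} {X : Fin n → Set} → (∀ i → Representation (X i)) → Representation (Σ (Fin n) X)
  ∐ᴿ {n} R .code        = `∐ n λ i → code (R i)
  ∐ᴿ R .enc (i , x)     = i , enc (R i) x
  ∐ᴿ {n} {X} R .injective {i , x} {j , y} eq = go i j x y eq
    where
    go : ∀ i j (x : X i) (y : X j) → (i , enc (R i) x) ≡ (j , enc (R j) y) → (i , x) ≡ (j , y)
    go i j x y eq with ,-injectiveˡ eq
    ... | refl = cong (i ,_) (injective (R i) (,-injectiveʳ-UIP (Decidable⇒UIP.≡-irrelevant _≟_) eq))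

  -- X has a linear order that a program decides in constant time.
  ConstantTimeOrder : {X : Set} → Representation X → Set₁
  ConstantTimeOrder {X} R =
    ∃ λ (_⊑_ : Rel X 0ℓ) → IsTotalOrder _≡_ _⊑_ ×
      ∃ λ (p : Prog (code R `× code R) `Bool) →
        (∀ x y → (eval p (enc R x , enc R y) ≡ `true) ⇔ (x ⊑ y)) ×
        ∃ λ c → ∀ x y → cost p (enc R x , enc R y) ≤ c

module Efficiency (em : ExcludedMiddle 0ℓ) (M : Machine) where

  open Classical em
  open Programs M

  record Representations {H : Functor} {E : Encoding H} (D : InterfaceData H E) : Set where
    field
      labels  : Representation (Label E)
      weights : Representation (Weight D)
      H𝟏      : Representation (F₀ H 𝟏)
      H𝟑      : Representation (F₀ H 𝟑)

  open Representations public

  ∐ᴿˢ : {n : ℕ} {H : Fin n → Functor} {E : ∀ i → Encoding (H i)} {D : ∀ i → InterfaceData (H i) (E i)} →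
        (∀ i → Representations (D i)) → Representations (∐ᴰ D)
  ∐ᴿˢ R .labels  = ∐ᴿ λ i → labels (R i)
  ∐ᴿˢ R .weights = ∐ᴿ λ i → weights (R i)
  ∐ᴿˢ R .H𝟏      = ∐ᴿ λ i → H𝟏 (R i)
  ∐ᴿˢ R .H𝟑      = ∐ᴿ λ i → H𝟑 (R i)

  -- Bags of labels are passed to programs as lists; each bag ⌊ as ⌋ is
  -- represented by all lists `as` enumerating it.

  module _ {H : Functor} {E : Encoding H} (D : InterfaceData H E) (R : Representations D) where

    InitLinear : Set
    InitLinear =
      LinearTime {F₀ H 𝟏 × List (Label E)}
        (code (H𝟏 R) `× list (code (labels R)))
        (code (weights R))
        (λ (t , as) → enc (H𝟏 R) t , List.map (enc (labels R)) as)
        (λ (t , as) → enc (weights R) (init D (t , ⌊ as ⌋)))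

    UpdateLinear : Set
    UpdateLinear =
      LinearTime {List (Label E) × Weight D}
        (list (code (labels R)) `× code (weights R))
        (code (weights R) `× code (H𝟑 R) `× code (weights R))
        (λ (as , v) → List.map (enc (labels R)) as , enc (weights R) v)
        (λ (as , v) → let v₁ , t , v₂ = update D (⌊ as ⌋ , v) in
                      enc (weights R) v₁ , enc (H𝟑 R) t , enc (weights R) v₂)

    Efficient : Set₁
    Efficient = Zippable H × InitLinear × UpdateLinear × ConstantTimeOrder (H𝟑 R)

{-# OPTIONS --safe #-}

-- Since in_i is injective, filter_i undoes the tagging of labels in ♭ and
-- commutes with fil_S, so both equations for H reduce to those for H_i.
-- For the running times, one pass over the list of labels computes filter_i
-- without enlarging the input; the program for H_i then runs on the result.
-- As there are finitely many i, the constants have a common bound.  H3 is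
-- ordered lexicographically, first by the index of the summand.
module Submission where

open import Defs
open import Axiom.ExcludedMiddle using (ExcludedMiddle)
open import Axiom.UniquenessOfIdentityProofs using (module Decidable⇒UIP)
open import Data.Bool.Base using (if_then_else_)
open import Data.Fin.Base using (Fin; zero; suc; _<_)
open import Data.Fin.Properties using (_≟_; <-cmp; <-asym; <-irrefl; <-trans)
open import Data.List.Base as List using (List; []; _∷_; allFin; deduplicate)
open import Data.List.Extrema.Nat using (max; xs≤max)
open import Data.List.Membership.Propositional using (_∈_)
open import Data.List.Membership.Propositional.Properties using (∈-map⁺; ∈-allFin; ∈-deduplicate⁺)
open import Data.List.Properties using (map-∘)
open import Data.List.Relation.Unary.All as All using (All; []; _∷_)
open import Data.List.Relation.Unary.Any using (here; there)
open import Data.List.Relation.Unary.Unique.DecPropositional.Properties using (deduplicate-!)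
open import Data.List.Relation.Unary.Unique.Propositional using (Unique; []; _∷_)
open import Data.Nat.Base using (ℕ; zero; suc; _+_; _*_; _≤_; z≤n; s≤s)
open import Data.Nat.Properties as ℕ using
  ( +-comm; +-identityʳ; +-mono-≤; +-monoˡ-≤; +-monoʳ-≤; *-distribʳ-+; *-monoʳ-≤; *-mono-≤
  ; m≤m+n; m≤n+m; m≤m*n; ≤-reflexive; ≤-refl; ≤-trans; module ≤-Reasoning )
open import Data.Nat.Tactic.RingSolver using (solve-∀)
open import Data.Product.Base using (Σ; ∃; _×_; _,_; proj₁; proj₂; map₁; map₂; swap)
open import Data.Product.Properties using (,-injectiveˡ; ,-injectiveʳ; ,-injectiveʳ-UIP)
open import Data.Sum.Base as Sum using (inj₁; inj₂)
open import Function.Base using (_∘_; id)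
open import Function.Bundles using (mk⇔; module Equivalence)
open import Function.Definitions using (Injective)
open import Level using (0ℓ)
open import Relation.Binary.Core using (Rel)
open import Relation.Binary.Definitions using (Tri; tri<; tri≈; tri>)
open import Relation.Binary.PropositionalEquality
  using (_≡_; _≢_; refl; sym; trans; cong; cong₂; isEquivalence)
open import Relation.Binary.Structures using (IsTotalOrder)
open import Relation.Nullary using (Dec; yes; no; does; contradiction)
open import Relation.Nullary.Decidable using (dec-true; dec-false)
open import Relation.Unary using (Pred; U)

private variable
  n : ℕ

-- Coproduct injections and zippability.

in-injective : {A : Fin n → Set} {i : Fin n} → Injective _≡_ _≡_ (λ (a : A i) → _,_ {B = A} i a)
-- Equality on `Fin n` is decidable, so a proof of `i ≡ i` is unique and the second components agree
-- without transport.
in-injective = ,-injectiveʳ-UIP (Decidable⇒UIP.≡-irrelevant _≟_)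

-- `fmap` keeps the index, so equal images come from one summand, where zippability of `H i`
-- applies.
∐-zippable : {H : Fin n → Functor} → (∀ i → Zippable (H i)) → Zippable (∐ H)
∐-zippable zip A B {i , t} {j , t′} eq with cong proj₁ (,-injectiveˡ eq)
... | refl = cong (i ,_) (zip i A B (cong₂ _,_ (in-injective (,-injectiveˡ eq))
                                               (in-injective (,-injectiveʳ eq))))

-- Uniform bounds, finite sums and selection from lists.

bounded : (f : Fin n → ℕ) → ∃ λ c → ∀ i → f i ≤ c
bounded f = max 0 (List.map f (allFin _)) , λ i → All.lookup (xs≤max 0 _) (∈-map⁺ f (∈-allFin i))

sumOf-cong : {Z : Set} (zs : List Z) {f f′ : Z → ℕ} → (∀ z → f z ≡ f′ z) → sumOf zs f ≡ sumOf zs f′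
sumOf-cong []       f≗f′ = refl
sumOf-cong (z ∷ zs) f≗f′ = cong₂ _+_ (f≗f′ z) (sumOf-cong zs f≗f′)

sumOf-≡0 : {Z : Set} {zs : List Z} (f : Z → ℕ) → All (λ z → f z ≡ 0) zs → sumOf zs f ≡ 0
sumOf-≡0 f []         = refl
sumOf-≡0 f (fz ∷ fzs) = cong₂ _+_ fz (sumOf-≡0 f fzs)

select-map : {A B : Fin n → Set} (f : ∀ i → A i → B i) (i : Fin n) (zs : List (Σ (Fin n) A)) →
             select i (List.map (map₂ (f _)) zs) ≡ List.map (f i) (select i zs)
select-map f i []             = refl
select-map f i ((j , a) ∷ zs) with j ≟ i
... | yes refl = cong (f i a ∷_) (select-map f i zs)
... | no _     = select-map f i zs

-- Filtering of tagged bags.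

module _ (em : ExcludedMiddle 0ℓ) where

  open Classical em

  -- A list without repetitions meets `x` at most once, so at most one term survives. If `x` does
  -- not occur, the last hypothesis forces `f x` to be 0.
  sumOf-singleton : {Z : Set} {zs : List Z} (f : Z → ℕ) (x : Z) → Unique zs →
                    (∀ z → z ≢ x → f z ≡ 0) → (f x ≢ 0 → x ∈ zs) → sumOf zs f ≡ f x
  sumOf-singleton {zs = []} f x [] off supp with f x
  ... | zero  = refl
  ... | suc _ = contradiction (supp λ ()) λ ()
  sumOf-singleton {zs = z ∷ zs} f x (z∉zs ∷ uniq) off supp with decEq z x
  -- Uniqueness makes every later entry differ from the head `x`, so the tail contributes 0.
  ... | yes refl = trans (cong (f x +_) (sumOf-≡0 f (All.map (λ x≢y → off _ (x≢y ∘ sym)) z∉zs)))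
                         (+-identityʳ (f x))
  ... | no z≢x   = cong₂ _+_ (off z z≢x) (sumOf-singleton f x uniq off (tail ∘ supp))
    where
    tail : x ∈ z ∷ zs → x ∈ zs
    tail (here x≡z)   = contradiction (sym x≡z) z≢x
    tail (there x∈zs) = x∈zs

  -- The fibre of an injective `h` over `h z` is `z` alone, so the sum defining the multiplicity
  -- collapses to one term.
  mapᵇ-mult : {Z Z′ : Set} {h : Z → Z′} → Injective _≡_ _≡_ h → (g : Bag Z) (z : Z) →
              mult (mapᵇ h g) (h z) ≡ mult g z
  mapᵇ-mult {Z} {h = h} inj g z =
    trans (sumOf-singleton term z (deduplicate-! decEq (support g)) off supp) at-z
    where
    term : Z → ℕ
    term y = if does (em {h y ≡ h z}) then mult g y else 0

    off : ∀ y → y ≢ z → term y ≡ 0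
    off y y≢z = cong (λ b → if b then mult g y else 0) (dec-false em (y≢z ∘ inj))

    at-z : term z ≡ mult g z
    at-z = cong (λ b → if b then mult g z else 0) (dec-true em refl)

    supp : term z ≢ 0 → z ∈ deduplicate decEq (support g)
    supp t≢0 = ∈-deduplicate⁺ decEq (supported g z (t≢0 ∘ trans at-z))

  filterᵢ-fil : {A : Fin n → Set} {X : Set} (i : Fin n) (S : Pred X 0ℓ) (g : Bag (A i × X)) →
                filterᵢ i (fil S (mapᵇ (map₁ (_,_ {B = A} i)) g)) ≈ fil S g
  filterᵢ-fil {A = A} {X} i S g a = trans
    -- Tagging changes labels only, so the supports of `tagged` and `g` have the same second
    -- components, and both sums run over one list.
    (cong (λ ys → ∑[ ys ∈ S ] λ y → mult tagged ((i , a) , y)) (sym (map-∘ (support g))))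
    (sumOf-cong (deduplicate decEq (List.map proj₂ (support g))) λ y →
       cong (λ m → if does (em {S y}) then m else 0) (mapᵇ-mult tag-injective g (a , y)))
    where
    tag : A i × X → Σ _ A × X
    tag = map₁ (i ,_)

    tagged : Bag (Σ _ A × X)
    tagged = mapᵇ tag g

    tag-injective : Injective _≡_ _≡_ tag
    tag-injective eq = cong₂ _,_ (in-injective (,-injectiveˡ eq)) (,-injectiveʳ eq)

  -- Links what programs compute on lists of labels with the bag operation occurring in `init` and
  -- `update`.
  filterᵢ-⌊⌋ : {A : Fin n → Set} (i : Fin n) (as : List (Σ (Fin n) A)) → ⌊ select i as ⌋ ≈ filterᵢ i ⌊ as ⌋
  filterᵢ-⌊⌋ i []             a = refl
  filterᵢ-⌊⌋ {A = A} i ((j , b) ∷ as) a with j ≟ i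
  -- The two sides decide equality separately, for labels and for tagged labels. Injectivity of
  -- tagging excludes the mixed outcomes.
  filterᵢ-⌊⌋ {A = A} i ((j , b) ∷ as) a | yes refl with decEq a b | decEq {Σ _ A} (i , a) (i , b)
  ... | yes _    | yes _    = cong suc (filterᵢ-⌊⌋ i as a)
  ... | no _     | no _     = filterᵢ-⌊⌋ i as a
  ... | yes refl | no neq   = contradiction refl neq
  ... | no a≢b   | yes eq   = contradiction (in-injective eq) a≢b
  filterᵢ-⌊⌋ {A = A} i ((j , b) ∷ as) a | no j≢i with decEq {Σ _ A} (i , a) (j , b)
  ... | yes eq = contradiction (sym (,-injectiveˡ eq)) j≢i
  ... | no _   = filterᵢ-⌊⌋ i as a

  -- The equations of the refinement interface for the coproduct.

  module _ {H : Fin n → Functor} {E : ∀ i → Encoding (H i)} {D : ∀ i → InterfaceData (H i) (E i)}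
           (I : ∀ i → IsRefinementInterface (E i) (D i)) where

    open module Interface i = IsRefinementInterface (I i)

    ∐-isRefinementInterface : IsRefinementInterface (∐ᴱ E) (∐ᴰ D)
    ∐-isRefinementInterface = record
      { init-cong     = λ (i , t) g≈g′ → cong (i ,_) (init-cong i t (g≈g′ ∘ (i ,_)))
      ; update-cong   = λ (i , v) g≈g′ → cong (tag i) (update-cong i v (g≈g′ ∘ (i ,_)))
      ; weight-cong   = λ X fin S≐S′ (i , t) → cong (i ,_) (weight-cong i X fin S≐S′ t)
      ; init-weight   = λ X fin (i , t) → cong (i ,_)
          -- `filterᵢ-fil` yields equality up to `≈` only; `init-cong` turns it into an equation
          -- between weights.
          (trans (init-cong i _ {g′ = fil U (♭ (E i) X t)} (filterᵢ-fil {A = Label ∘ E} i U (♭ (E i) X t)))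
                 (init-weight i X fin t))
      ; update-weight = λ X fin S C S⊆C (i , t) → cong (tag i)
          (trans (update-cong i {g′ = fil S (♭ (E i) X t)} _ (filterᵢ-fil {A = Label ∘ E} i S (♭ (E i) X t)))
                 (update-weight i X fin S C S⊆C t))
      }
      where
      tag : ∀ i → Weight (D i) × F₀ (H i) 𝟑 × Weight (D i) →
            Weight (∐ᴰ D) × F₀ (∐ H) 𝟑 × Weight (∐ᴰ D)
      tag i (v₁ , t , v₂) = (i , v₁) , (i , t) , (i , v₂)

-- The lexicographic order on a coproduct.

data Lex {X : Fin n → Set} (_⊑_ : ∀ i → Rel (X i) 0ℓ) : Rel (Σ (Fin n) X) 0ℓ where
  index< : ∀ {i j x y} → i < j → Lex _⊑_ (i , x) (j , y)
  index≡ : ∀ {i x y} → _⊑_ i x y → Lex _⊑_ (i , x) (i , y)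

module _ {X : Fin n → Set} {_⊑_ : ∀ i → Rel (X i) 0ℓ} (total : ∀ i → IsTotalOrder _≡_ (_⊑_ i)) where

  private module T i = IsTotalOrder (total i)

  Lex-isTotalOrder : IsTotalOrder _≡_ (Lex _⊑_)
  Lex-isTotalOrder = record
    { isPartialOrder = record
      { isPreorder = record
        { isEquivalence = isEquivalence
        ; reflexive     = λ { {i , _} refl → index≡ (T.refl i) }
        ; trans         = lex-trans
        }
      ; antisym = antisym
      }
    ; total = lex-total
    }
    where
    lex-trans : ∀ {x y z} → Lex _⊑_ x y → Lex _⊑_ y z → Lex _⊑_ x z
    lex-trans (index< i<j)     (index< j<k) = index< (<-trans i<j j<k)
    lex-trans (index< i<j)     (index≡ _)   = index< i<j
    lex-trans (index≡ _)       (index< i<j) = index< i<j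
    lex-trans (index≡ {i} x⊑y) (index≡ y⊑z) = index≡ (T.trans i x⊑y y⊑z)

    antisym : ∀ {x y} → Lex _⊑_ x y → Lex _⊑_ y x → x ≡ y
    antisym (index< i<j)     (index< j<i) = contradiction j<i (<-asym i<j)
    antisym (index< i<i)     (index≡ _)   = contradiction i<i (<-irrefl refl)
    antisym (index≡ _)       (index< i<i) = contradiction i<i (<-irrefl refl)
    antisym (index≡ {i} x⊑y) (index≡ y⊑x) = cong (i ,_) (T.antisym i x⊑y y⊑x)

    lex-total : ∀ x y → Lex _⊑_ x y Sum.⊎ Lex _⊑_ y x
    lex-total (i , x) (j , y) with <-cmp i j
    ... | tri< i<j _ _  = inj₁ (index< i<j)
    ... | tri> _ _ j<i  = inj₂ (index< j<i)
    ... | tri≈ _ refl _ = Sum.map index≡ index≡ (T.total i x y)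

-- Combining linear-time programs.

absorb : ∀ a c s → a + c * suc s ≤ (a + c) * suc s
absorb a c s = begin
  -- The factor `suc s` is the `1 + size` of `LinearTime`. It is at least 1, so a constant overhead
  -- `a` can be charged to the multiplier.
  a + c * suc s          ≤⟨ +-monoˡ-≤ (c * suc s) (m≤m*n a (suc s)) ⟩
  a * suc s + c * suc s  ≡⟨ *-distribʳ-+ (suc s) a c ⟨
  (a + c) * suc s        ∎
  where open ≤-Reasoning

module _ (M : Machine) where

  open Programs M

  private variable
    ρ σ τ υ : Ty Base

  swapᴾ : Prog (σ `× τ) (τ `× σ)
  swapᴾ = fork snd fst

  -- `init` receives its bag second and `update` receives it first; exchanging the inputs lets one
  -- dispatch lemma serve both.
  LinearTime-swap : {I : Set} {inp : I → ⟦ σ `× τ ⟧} {out : I → ⟦ υ ⟧} →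
                    LinearTime (σ `× τ) υ inp out → LinearTime (τ `× σ) υ (swap ∘ inp) out
  LinearTime-swap {σ = σ} {τ = τ} {inp = inp} (p , correct , c , bound) =
    -- The 4 consists of 3 for `swapᴾ` and 1 for the composition.
    swapᴾ ⨾ p , correct , 4 + c , λ x → let s , t = inp x in begin
      4 + cost p (s , t)                  ≤⟨ +-monoʳ-≤ 4 (bound x) ⟩
      4 + c * (1 + (size σ s + size τ t)) ≡⟨ cong (λ m → 4 + c * suc m) (+-comm (size σ s) (size τ t)) ⟩
      4 + c * (1 + (size τ t + size σ s)) ≤⟨ absorb 4 c (size τ t + size σ s) ⟩
      (4 + c) * (1 + (size τ t + size σ s)) ∎
    where open ≤-Reasoning

  LinearTime-⨾ : {I : Set} {inp : I → ⟦ σ ⟧} {out : I → ⟦ τ ⟧} →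
                 LinearTime σ τ inp out → (q : Prog τ υ) (k : ℕ) → (∀ y → cost q y ≤ k) →
                 LinearTime σ υ inp (eval q ∘ out)
  LinearTime-⨾ {σ = σ} {inp = inp} (p , correct , c , bound) q k q≤k =
    p ⨾ q , cong (eval q) ∘ correct , suc k + c , λ x → begin
      1 + (cost p (inp x) + cost q (eval p (inp x)))  ≤⟨ s≤s (+-mono-≤ (bound x) (q≤k _)) ⟩
      1 + (c * (1 + size σ (inp x)) + k)              ≡⟨ cong suc (+-comm (c * _) k) ⟩
      suc k + c * (1 + size σ (inp x))                ≤⟨ absorb (suc k) c (size σ (inp x)) ⟩
      (suc k + c) * (1 + size σ (inp x))              ∎
    where open ≤-Reasoning

  -- Reindexes the inputs and lets a computed output be replaced by the specified one.
  LinearTime-map : {I J : Set} {inp : I → ⟦ σ ⟧} {out : I → ⟦ τ ⟧} {out′ : J → ⟦ τ ⟧} →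
                   LinearTime σ τ inp out → (f : J → I) → (∀ x → out (f x) ≡ out′ x) →
                   LinearTime σ τ (inp ∘ f) out′
  LinearTime-map (p , correct , c , bound) f out≡ =
    p , (λ x → trans (correct (f x)) (out≡ x)) , c , bound ∘ f

  -- Selecting the labels of one summand in a single pass.

  module _ {σ : Fin n → Ty Base} (i : Fin n) where

    -- `case` has one branch for each `j`, so `j` is compared with `i` while the program is
    -- assembled, and no test is charged at run time.
    keepᴾ : ∀ {j} → Dec (j ≡ i) → Prog (list (σ i) `× σ j) (list (σ i))
    keepᴾ (yes refl) = swapᴾ ⨾ cons
    keepᴾ (no _)     = fst

    selectStepᴾ : Prog (`1 `× `∐ n σ `× list (σ i)) (list (σ i))
    selectStepᴾ = snd ⨾ swapᴾ ⨾ case λ j → keepᴾ (j ≟ i)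

    selectᴾ : Prog (list (`∐ n σ)) (list (σ i))
    -- `fold` expects a parameter beside the list; `unit` supplies a dummy one.
    selectᴾ = fork unit skip ⨾ fold nil selectStepᴾ

    selectᴾ-correct : ∀ xs → eval selectᴾ xs ≡ select i xs
    selectᴾ-correct []             = refl
    selectᴾ-correct ((j , x) ∷ xs) with j ≟ i
    ... | yes refl = cong (x ∷_) (selectᴾ-correct xs)
    ... | no _     = selectᴾ-correct xs

    keepᴾ-cost : ∀ {j} (d : Dec (j ≡ i)) y → cost (keepᴾ d) y ≤ 5
    keepᴾ-cost (yes refl) _ = ≤-refl
    keepᴾ-cost (no _)     _ = s≤s z≤n

    selectᴾ-cost : ∀ xs → cost selectᴾ xs ≤ 4 + 13 * size (list (`∐ n σ)) xs
    selectᴾ-cost xs = +-monoʳ-≤ 4 (fold-cost xs)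
      where
      open ≤-Reasoning
      fold-cost : ∀ xs → cost (fold nil selectStepᴾ) (_ , xs) ≤ 13 * size (list (`∐ n σ)) xs
      fold-cost []             = s≤s (s≤s z≤n)
      fold-cost ((j , x) ∷ xs) = begin
        -- The 8 covers the `fold` step and `selectStepᴾ` up to its branch. With at most 5 for
        -- `keepᴾ`, each entry costs at most 13.
        8 + (cost (keepᴾ (j ≟ i)) (_ , x) + cost (fold nil selectStepᴾ) (_ , xs))
          ≤⟨ +-monoʳ-≤ 8 (+-mono-≤ (keepᴾ-cost (j ≟ i) _) (fold-cost xs)) ⟩
        13 + 13 * size (list (`∐ n σ)) xs
          ≡⟨ ℕ.*-suc 13 (size (list (`∐ n σ)) xs) ⟨
        13 * (1 + size (list (`∐ n σ)) xs)
          ≤⟨ *-monoʳ-≤ 13 (s≤s (s≤s (m≤n+m _ (1 + size (σ j) x)))) ⟩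
        13 * size (list (`∐ n σ)) ((j , x) ∷ xs) ∎

    -- Dropping entries and tags only shrinks the input. Hence a bound in the size of the selected
    -- list is also one in the size of the whole list.
    select-size : ∀ xs → size (list (σ i)) (select i xs) ≤ size (list (`∐ n σ)) xs
    select-size []             = ≤-refl
    select-size ((j , x) ∷ xs) with j ≟ i
    ... | yes refl = s≤s (s≤s (≤-trans (+-monoʳ-≤ (size (σ i) x) (ℕ.≤-pred (select-size xs)))
                                       (ℕ.n≤1+n _)))
    ... | no _     = ≤-trans (select-size xs) (s≤s (m≤n+m _ (2 + size (σ j) x)))

  -- Dispatch on the summand.

  encᴸ : {A T : Set} (R : Representation A) (S : Representation T) →
         List A × T → ⟦ list (code R) `× code S ⟧
  encᴸ R S (as , t) = List.map (enc R) as , enc S t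

  module _ {A T : Fin n → Set} (R : ∀ i → Representation (A i)) (S : ∀ i → Representation (T i)) where

    LinearTime-dispatch :
      {out : ∀ i → List (A i) × T i → ⟦ υ ⟧} →
      (∀ i → LinearTime (list (code (R i)) `× code (S i)) υ
               (encᴸ (R i) (S i)) (out i)) →
      LinearTime (list (code (∐ᴿ R)) `× code (∐ᴿ S)) υ
        (encᴸ (∐ᴿ R) (∐ᴿ S))
        (λ (as , i , t) → out i (select i as , t))
    LinearTime-dispatch {υ = υ} {out = out} lin =
      -- The 23 is 10 for fixed overhead plus the factor 13 of `selectᴾ-cost`; `C` bounds the
      -- multipliers of all the programs `prog i`.
      case branch , correct , 23 + C , bound
      where
      open ≤-Reasoning

      prog : ∀ i → Prog (list (code (R i)) `× code (S i)) υ
      prog i = proj₁ (lin i)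

      c : Fin n → ℕ
      c i = proj₁ (proj₂ (proj₂ (lin i)))

      C : ℕ
      C = proj₁ (bounded c)

      branch : ∀ i → Prog (list (code (∐ᴿ R)) `× code (S i)) υ
      branch i = fork (fst ⨾ selectᴾ {σ = code ∘ R} i) snd ⨾ prog i

      selected : ∀ i as → eval (selectᴾ {σ = code ∘ R} i) (List.map (enc (∐ᴿ R)) as) ≡
                          List.map (enc (R i)) (select i as)
      selected i as = trans (selectᴾ-correct {σ = code ∘ R} i (List.map (enc (∐ᴿ R)) as))
                            (select-map (λ i → enc (R i)) i as)

      correct : ∀ x → let as , i , t = x in
                eval (branch i) (List.map (enc (∐ᴿ R)) as , enc (S i) t) ≡ out i (select i as , t)
      correct (as , i , t) = trans (cong (λ bs → eval (prog i) (bs , enc (S i) t)) (selected i as))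
                                   (proj₁ (proj₂ (lin i)) (select i as , t))

      bound : ∀ x → let as , i , t = x
                        bs = List.map (enc (∐ᴿ R)) as in
              1 + cost (branch i) (bs , enc (S i) t) ≤
              (23 + C) * (1 + (size (list (code (∐ᴿ R))) bs + (1 + size (code (S i)) (enc (S i) t))))
      bound (as , i , t) = begin
        1 + cost (branch i) (bs , u)
          ≡⟨ cong (λ cs → 5 + (cost (selectᴾ {σ = code ∘ R} i) bs + 1 + cost (prog i) (cs , u))) (selected i as) ⟩
        5 + (cost (selectᴾ {σ = code ∘ R} i) bs + 1 + cost (prog i) (cs , u))
          ≤⟨ +-monoʳ-≤ 5 (+-mono-≤ (+-monoˡ-≤ 1 (selectᴾ-cost {σ = code ∘ R} i bs))
                                   (proj₂ (proj₂ (proj₂ (lin i))) (select i as , t))) ⟩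
        5 + (4 + 13 * s + 1 + c i * (1 + (size (list (code (R i))) cs + r)))
          ≤⟨ +-monoʳ-≤ 5 (+-monoʳ-≤ (4 + 13 * s + 1)
               (*-mono-≤ (proj₂ (bounded c) i) (s≤s (+-mono-≤ size-cs (ℕ.n≤1+n r))))) ⟩
        5 + (4 + 13 * s + 1 + C * (1 + (s + (1 + r))))
          ≡⟨ collect s (C * (1 + (s + (1 + r)))) ⟩
        10 + (13 * s + C * (1 + (s + (1 + r))))
          ≤⟨ +-monoʳ-≤ 10 (+-monoˡ-≤ _ (*-monoʳ-≤ 13 (≤-trans (m≤m+n s (1 + r)) (ℕ.n≤1+n _)))) ⟩
        10 + (13 * (1 + (s + (1 + r))) + C * (1 + (s + (1 + r))))
          ≡⟨ cong (10 +_) (*-distribʳ-+ (1 + (s + (1 + r))) 13 C) ⟨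
        10 + (13 + C) * (1 + (s + (1 + r)))
          ≤⟨ absorb 10 (13 + C) (s + (1 + r)) ⟩
        (23 + C) * (1 + (s + (1 + r))) ∎
        where
        bs = List.map (enc (∐ᴿ R)) as
        cs = List.map (enc (R i)) (select i as)
        u  = enc (S i) t
        s  = size (list (code (∐ᴿ R))) bs
        r  = size (code (S i)) u

        size-cs : size (list (code (R i))) cs ≤ s
        -- Encoding commutes with selection, so `cs` is a selection from `bs` and `select-size`
        -- applies.
        size-cs = ≤-trans (≤-reflexive (cong (size (list (code (R i))))
                                             (sym (select-map (λ i → enc (R i)) i as))))
                          (select-size {σ = code ∘ R} i bs)

        collect : ∀ s z → 5 + (4 + 13 * s + 1 + z) ≡ 10 + (13 * s + z)
        collect = solve-∀

  -- Deciding the lexicographic order in constant time.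

  compareᴾ : {σ : Fin n → Ty Base} → (∀ i → Prog (σ i `× σ i) `Bool) →
             ∀ {i j} → Tri (i < j) (i ≡ j) (j < i) → Prog (σ i `× σ j) `Bool
  compareᴾ p (tri< _ _ _)        = unit ⨾ inj zero
  compareᴾ p {i} (tri≈ _ refl _) = p i
  compareᴾ p (tri> _ _ _)        = unit ⨾ inj (suc zero)

  -- The nested `case`s fix both indices, so `<-cmp` acts during assembly of the program and only
  -- equal indices require a comparison inside a summand. The two swaps bring each argument into the
  -- position that `case` inspects and restore the original order.
  lexᴾ : {σ : Fin n → Ty Base} → (∀ i → Prog (σ i `× σ i) `Bool) → Prog (`∐ n σ `× `∐ n σ) `Bool
  lexᴾ p = swapᴾ ⨾ case λ i → swapᴾ ⨾ case λ j → compareᴾ p (<-cmp i j)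

  ∐-constantTimeOrder : {X : Fin n → Set} {R : ∀ i → Representation (X i)} →
                        (∀ i → ConstantTimeOrder (R i)) → ConstantTimeOrder (∐ᴿ R)
  ∐-constantTimeOrder {n} {X} {R} ord =
    Lex _⊑_ , Lex-isTotalOrder (λ i → proj₁ (proj₂ (ord i))) , lexᴾ p ,
    (λ (i , x) (j , y) → mk⇔ (sound (<-cmp i j) x y) (complete (<-cmp i j) x y)) ,
    -- The swaps, `case`s and compositions of `lexᴾ` cost 10; a branch with distinct indices costs
    -- 3, and one with equal indices at most `C`.
    13 + C , λ (i , x) (j , y) → +-monoʳ-≤ 10 (bound (<-cmp i j) x y)
    where
    _⊑_ : ∀ i → Rel (X i) 0ℓ
    _⊑_ i = proj₁ (ord i)

    p : ∀ i → Prog (code (R i) `× code (R i)) `Bool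
    p i = proj₁ (proj₂ (proj₂ (ord i)))

    module Decides i x y = Equivalence (proj₁ (proj₂ (proj₂ (proj₂ (ord i)))) x y)

    c : Fin n → ℕ
    c i = proj₁ (proj₂ (proj₂ (proj₂ (proj₂ (ord i)))))

    C : ℕ
    C = proj₁ (bounded c)

    sound : ∀ {i j} (tri : Tri (i < j) (i ≡ j) (j < i)) x y →
            eval (compareᴾ p tri) (enc (R i) x , enc (R j) y) ≡ `true → Lex _⊑_ (i , x) (j , y)
    sound (tri< i<j _ _)      x y eq = index< i<j
    sound {i} (tri≈ _ refl _) x y eq = index≡ (Decides.to i x y eq)
    sound (tri> _ _ _)        x y ()

    complete : ∀ {i j} (tri : Tri (i < j) (i ≡ j) (j < i)) x y →
               Lex _⊑_ (i , x) (j , y) → eval (compareᴾ p tri) (enc (R i) x , enc (R j) y) ≡ `true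
    complete (tri< _ _ _)        x y _            = refl
    complete (tri≈ i≮i refl _)   x y (index< i<i) = contradiction i<i i≮i
    complete {i} (tri≈ _ refl _) x y (index≡ x⊑y) = Decides.from i x y x⊑y
    complete (tri> i≮j _ _)      x y (index< i<j) = contradiction i<j i≮j
    complete (tri> _ i≢i _)      x y (index≡ _)   = contradiction refl i≢i

    bound : ∀ {i j} (tri : Tri (i < j) (i ≡ j) (j < i)) x y →
            cost (compareᴾ p tri) (enc (R i) x , enc (R j) y) ≤ 3 + C
    bound (tri< _ _ _)        x y = m≤m+n 3 C
    bound {i} (tri≈ _ refl _) x y =
      ≤-trans (proj₂ (proj₂ (proj₂ (proj₂ (proj₂ (ord i))))) x y)
              (≤-trans (proj₂ (bounded c) i) (m≤n+m C 3))
    bound (tri> _ _ _)        x y = m≤m+n 3 C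

-- Efficiency of the coproduct interface.

module _ (em : ExcludedMiddle 0ℓ) (M : Machine) where

  open Classical em
  open Programs M
  open Efficiency em M

  module _ {H : Fin n → Functor} {E : ∀ i → Encoding (H i)} {D : ∀ i → InterfaceData (H i) (E i)}
           (I : ∀ i → IsRefinementInterface (E i) (D i)) (R : ∀ i → Representations (D i)) where

    ∐-initLinear : (∀ i → InitLinear (D i) (R i)) → InitLinear (∐ᴰ D) (∐ᴿˢ R)
    ∐-initLinear lin =
      LinearTime-map M {inp = swap ∘ inp} (LinearTime-swap M {inp = inp} dispatched) swap
        λ ((i , t) , as) → cong (λ w → i , enc (weights (R i)) w)
          -- The program runs on the selected list, whose bag agrees with `filterᵢ i ⌊ as ⌋` up to
          -- `≈`.
          (IsRefinementInterface.init-cong (I i) t {g = ⌊ select i as ⌋} (filterᵢ-⌊⌋ em i as))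
      where
      inp : List (Label (∐ᴱ E)) × F₀ (∐ H) 𝟏 → ⟦ list (code (labels (∐ᴿˢ R))) `× code (H𝟏 (∐ᴿˢ R)) ⟧
      inp = encᴸ M (labels (∐ᴿˢ R)) (H𝟏 (∐ᴿˢ R))

      inpᵢ : ∀ i → List (Label (E i)) × F₀ (H i) 𝟏 → ⟦ list (code (labels (R i))) `× code (H𝟏 (R i)) ⟧
      inpᵢ i = encᴸ M (labels (R i)) (H𝟏 (R i))

      out : ∀ i → List (Label (E i)) × F₀ (H i) 𝟏 → ⟦ code (weights (R i)) ⟧
      out i (as , t) = enc (weights (R i)) (init (D i) (t , ⌊ as ⌋))

      swapped : ∀ i → LinearTime (list (code (labels (R i))) `× code (H𝟏 (R i))) (code (weights (R i)))
                        (inpᵢ i) (out i)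
      -- The inner swap reorders the program's input, the outer one the index set, so that lists of
      -- labels come first in both.
      swapped i = LinearTime-map M {inp = inpᵢ i ∘ swap}
        (LinearTime-swap M {inp = swap ∘ inpᵢ i ∘ swap} (lin i)) swap λ _ → refl

      dispatched : LinearTime (list (code (labels (∐ᴿˢ R))) `× code (H𝟏 (∐ᴿˢ R))) (code (weights (∐ᴿˢ R)))
                     inp (λ (as , i , t) → i , out i (select i as , t))
      dispatched = LinearTime-dispatch M (labels ∘ R) (H𝟏 ∘ R) {out = λ i x → i , out i x} λ i →
        LinearTime-⨾ M {inp = inpᵢ i} {out = out i} (swapped i) (inj i) 1 λ _ → ≤-refl

    ∐-updateLinear : (∀ i → UpdateLinear (D i) (R i)) → UpdateLinear (∐ᴰ D) (∐ᴿˢ R)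
    ∐-updateLinear lin =
      LinearTime-map M {inp = encᴸ M (labels (∐ᴿˢ R)) (weights (∐ᴿˢ R))} dispatched id
        λ (as , i , v) → cong (encode i)
          (IsRefinementInterface.update-cong (I i) {g = ⌊ select i as ⌋} v (filterᵢ-⌊⌋ em i as))
      where
      Result : Ty Base
      Result = code (weights (∐ᴿˢ R)) `× code (H𝟑 (∐ᴿˢ R)) `× code (weights (∐ᴿˢ R))

      tagᴾ : ∀ i → Prog (code (weights (R i)) `× code (H𝟑 (R i)) `× code (weights (R i))) Result
      tagᴾ i = fork (fst ⨾ inj i) (fork (snd ⨾ fst ⨾ inj i) (snd ⨾ snd ⨾ inj i))

      encode : ∀ i → Weight (D i) × F₀ (H i) 𝟑 × Weight (D i) → ⟦ Result ⟧
      encode i (v₁ , t , v₂) =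
        (i , enc (weights (R i)) v₁) , (i , enc (H𝟑 (R i)) t) , (i , enc (weights (R i)) v₂)

      out : ∀ i → List (Label (E i)) × Weight (D i) → ⟦ Result ⟧
      out i (as , v) = encode i (update (D i) (⌊ as ⌋ , v))

      dispatched : LinearTime (list (code (labels (∐ᴿˢ R))) `× code (weights (∐ᴿˢ R))) Result
                     (encᴸ M (labels (∐ᴿˢ R)) (weights (∐ᴿˢ R)))
                     (λ (as , i , v) → out i (select i as , v))
      dispatched = LinearTime-dispatch M (labels ∘ R) (weights ∘ R) {out = out} λ i →
        -- The cost of `tagᴾ i` is exactly 15 on every input.
        LinearTime-⨾ M {inp = encᴸ M (labels (R i)) (weights (R i))} (lin i) (tagᴾ i) 15 λ _ → ≤-refl

    ∐-efficient : (∀ i → Efficient (D i) (R i)) → Efficient (∐ᴰ D) (∐ᴿˢ R)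
    ∐-efficient eff =
      ∐-zippable {H = H} (λ i → proj₁ (eff i)) ,
      ∐-initLinear (λ i → proj₁ (proj₂ (eff i))) ,
      ∐-updateLinear (λ i → proj₁ (proj₂ (proj₂ (eff i)))) ,
      ∐-constantTimeOrder M {R = H𝟑 ∘ R} (λ i → proj₂ (proj₂ (proj₂ (eff i))))

proposition8p18 : (em : ExcludedMiddle 0ℓ) →
    let open Classical em in
    (n : ℕ) (H : Fin n → Functor) (E : ∀ i → Encoding (H i))
    (D : ∀ i → InterfaceData (H i) (E i)) →
    (∀ i → IsRefinementInterface (E i) (D i)) →
    IsRefinementInterface (∐ᴱ E) (∐ᴰ D) ×
    ((M : Machine) → let open Efficiency em M in
    (R : ∀ i → Representations (D i)) →
    (∀ i → Efficient (D i) (R i)) →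
    Efficient (∐ᴰ D) (∐ᴿˢ R))
proposition8p18 em n H E D I = ∐-isRefinementInterface em I , λ M R → ∐-efficient em M I R
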